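{- Let $m,n,t>0$ be integers with $t\le n$, and let $a,b\ge 0$ be integers with $a+b\le n-t$. (i) The number of small $(m,t)$-Schröder paths of height $n$ with exactly $b$ returns and exactly $n-t-a-b$ diagonal steps is $$\frac{t+b}{n}\binom{mn+a-1}{a}\binom{mn}{n-t-a-b}.$$ (ii) The number of $m$-divisible small $(m,t)$-Schröder paths of height $n$ with exactly $b$ returns and exactly $n-t-a-b$ diagonal steps is $$\frac{t+b}{n}\binom{mn+a-1}{a}\binom{n}{n-t-a-b}.$$
   Context: A small $(m,t)$-Schröder path of height $n$ is a lattice path from $(0,0)$ to $(mn,n)$ such that: it uses only steps $N=(0,1)$ (north), $E=(1,0)$ (east) or $D=(1,1)$ (diagonal); it stays weakly above the line $x=my$ (every lattice point $(p,q)$ visited satisfies $p\le mq$); it starts with at least $t$ north steps; and it has no diagonal step starting on the line $x=my$. It is $m$-divisible if every diagonal step ends at a point whose $x$-coordinate is divisible by $m$. A valley is a lattice point on the path preceded by an east step and followed by a north step; a return is a valley of the form $(mi,i)$ for some $i\in\{1,\ldots,n-1\}$. -}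

module Defs where

open import Data.Integer.Base using (+_)
open import Data.List.Base using (List; []; _∷_; length; take; replicate; filter; foldl)
open import Data.List.Membership.Propositional using (_∈_)
open import Data.List.Relation.Unary.All using (All)
open import Data.List.Relation.Unary.Unique.Propositional using (Unique)
open import Data.List.Scans.Base using (scanl)
open import Data.Nat.Base using (ℕ; suc; _*_; _≤_; _<_)
open import Data.Nat.Divisibility using (_∣_)
open import Data.Nat.Properties using (_≟_; _≤?_; _<?_)
open import Data.Product.Base using (_×_; _,_; proj₁)
open import Data.Rational.Base using (ℚ; _/_)
open import Function.Bundles using (_⇔_)
open import Level using (Level; _⊔_)
open import Relation.Binary.PropositionalEquality.Core using (_≡_)
open import Relation.Nullary.Decidable using (_×-dec_)
open import Relation.Nullary.Negation using (¬_)
open import Relation.Unary using (Pred; Decidable)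

private variable
  a ℓ : Level

-- "The number of x with P x is k": a duplicate-free list of length k whose
-- members are exactly the x satisfying P.
record HasCardinality {A : Set a} (P : Pred A ℓ) (k : ℕ) : Set (a ⊔ ℓ) where
  field
    elements : List A
    unique   : Unique elements
    exact    : ∀ x → x ∈ elements ⇔ P x
    size     : length elements ≡ k

ι : ℕ → ℚ
ι k = + k / 1

data Step : Set where
  N E D : Step

Path : Set
Path = List Step

Point : Set
Point = ℕ × ℕ

origin : Point
origin = 0 , 0

move : Point → Step → Point
move (x , y) N = x , suc y
move (x , y) E = suc x , y
move (x , y) D = suc x , suc y

endpoint : Path → Point
endpoint = foldl move origin

visited : Path → List Point
visited = scanl move origin

-- The starting points of the diagonal steps, one entry per diagonal step,
-- for a path that itself starts at p.
diagonalStartsFrom : Point → Path → List Point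
diagonalStartsFrom p []      = []
diagonalStartsFrom p (N ∷ w) = diagonalStartsFrom (move p N) w
diagonalStartsFrom p (E ∷ w) = diagonalStartsFrom (move p E) w
diagonalStartsFrom p (D ∷ w) = p ∷ diagonalStartsFrom (move p D) w

diagonalStarts : Path → List Point
diagonalStarts = diagonalStartsFrom origin

#diagonals : Path → ℕ
#diagonals w = length (diagonalStarts w)

valleysFrom : Point → Path → List Point
valleysFrom p []          = []
valleysFrom p (E ∷ N ∷ w) = move p E ∷ valleysFrom (move (move p E) N) w
valleysFrom p (s ∷ w)     = valleysFrom (move p s) w

valleys : Path → List Point
valleys = valleysFrom origin

OnLine : ℕ → Pred Point _
OnLine m (x , y) = x ≡ m * y

WeaklyAbove : ℕ → Pred Point _
WeaklyAbove m (x , y) = x ≤ m * y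

-- The points (m i , i) with 1 ≤ i ≤ n - 1.
ReturnPoint : (m n : ℕ) → Pred Point _
ReturnPoint m n (x , y) = OnLine m (x , y) × 1 ≤ y × y < n

returnPoint? : ∀ m n → Decidable (ReturnPoint m n)
returnPoint? m n (x , y) = (x ≟ m * y) ×-dec (1 ≤? y) ×-dec (y <? n)

#returns : (m n : ℕ) → Path → ℕ
#returns m n w = length (filter (returnPoint? m n) (valleys w))

record IsSmallSchröder (m t n : ℕ) (w : Path) : Set where
  field
    ends        : endpoint w ≡ (m * n , n)
    above       : All (WeaklyAbove m) (visited w)
    startsNorth : take t w ≡ replicate t N
    small       : All (λ p → ¬ OnLine m p) (diagonalStarts w)

IsDivisible : ℕ → Pred Path _
IsDivisible m w = All (λ p → m ∣ proj₁ (move p D)) (diagonalStarts w)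

SmallSchröder : (m t n b d : ℕ) → Pred Path _
SmallSchröder m t n b d w =
  IsSmallSchröder m t n w × #returns m n w ≡ b × #diagonals w ≡ d

DivisibleSmallSchröder : (m t n b d : ℕ) → Pred Path _
DivisibleSmallSchröder m t n b d w =
  IsDivisible m w × SmallSchröder m t n b d w

{-# OPTIONS --safe #-}
module Submission where

-- Decompose a suffix by its first step. Take a point strictly above the line
-- with M columns and a + b + d rows remaining, where b returns and d diagonals
-- are still to come, and let c be the number of remaining columns that admit a
-- diagonal. The number of suffixes is
--   C(M+a-1,a) C(c,d) − m C(M+a-1,a-1) C(c,d) − l C(M+a-1,a) C(c-1,d-1),
-- with l = m for all paths and l = 1 for m-divisible ones. By Pascal's rule this
-- expression satisfies the first-step recurrence. It does not depend on b, so
-- passing through a return costs nothing, and on the line with b = 0, where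
-- M = m (a + d) and c = l (a + d), it vanishes by absorption, as it must: the
-- path could only go on by making a return. After the initial t north steps,
-- M = mn and c = ln, and absorption turns it into the stated product.

open import Defs
open import Data.Empty using (⊥-elim)
open import Data.Integer.Base using (+_)
import Data.Integer.Base as ℤ
import Data.Integer.Properties as ℤ
open import Data.List.Base using ([]; _∷_; _++_; map; length; filter; foldl; take; replicate)
open import Data.List.Membership.Propositional using (_∈_)
open import Data.List.Membership.Propositional.Properties
  using (∈-map⁺; ∈-map⁻; ∈-++⁺ˡ; ∈-++⁺ʳ; ∈-++⁻)
open import Data.List.Properties
  using (∷-injectiveʳ; length-map; length-++; length-filter; filter-accept; filter-reject)
open import Data.List.Relation.Unary.All using (All; []; _∷_; universal)
import Data.List.Relation.Unary.AllPairs as AllPairs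
open import Data.List.Relation.Unary.Any using (here)
open import Data.List.Relation.Unary.Unique.Propositional using (Unique)
open import Data.List.Relation.Unary.Unique.Propositional.Properties using (map⁺; ++⁺)
open import Data.List.Scans.Base using (scanl)
open import Data.Nat.Base
  using (ℕ; zero; suc; NonZero; _+_; _*_; _∸_; _%_; _≤_; _<_; z≤n; s≤s; ≢-nonZero)
import Data.Nat.Base as ℕ
open import Data.Nat.Combinatorics using (_C_; nC1≡n; nCk≡nC[n∸k]; nCk+nC[k+1]≡[n+1]C[k+1])
open import Data.Nat.Divisibility
  using (_∣_; _∣?_; divides; divides-refl; m∣m*n; ∣m+n∣m⇒∣n; m%n≡0⇒n∣m)
open import Data.Nat.DivMod using (m≡m%n+[m/n]*n; m%n<n; m*n/n≡m; m<n⇒m/n≡0; +-distrib-/-∣ʳ)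
open import Data.Nat.Properties
open import Data.Nat.Tactic.RingSolver using (solve-∀)
open import Data.Product.Base using (∃; _×_; _,_; proj₁; proj₂)
open import Data.Rational.Base using (_/_; toℚᵘ) renaming (_*_ to _*ℚ_)
open import Data.Rational.Properties using (toℚᵘ-injective; toℚᵘ-homo-*; toℚᵘ-fromℚᵘ)
open import Data.Rational.Unnormalised.Base using (mkℚᵘ; *≡*) renaming (_*_ to _*ᵘ_)
import Data.Rational.Unnormalised.Properties as ℚᵘ
open import Data.Sum.Base using (inj₁; inj₂)
open import Data.Unit.Base using (⊤; tt)
open import Function.Base using (_∘_)
open import Function.Bundles using (_⇔_; mk⇔; Equivalence)
open import Level using (0ℓ)
open import Relation.Binary.PropositionalEquality
  using (_≡_; _≢_; refl; sym; trans; cong; cong₂; subst; subst₂; module ≡-Reasoning)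
open import Relation.Nullary using (¬_; yes; no; contradiction)
open import Relation.Unary using (Pred; Decidable)

-- Cardinalities of sets of words

module _ {A : Set} where

  cardinality-empty : {P : Pred A 0ℓ} → (∀ x → ¬ P x) → HasCardinality P 0
  cardinality-empty ¬P = record
    { elements = [] ; unique = AllPairs.[] ; size = refl
    ; exact = λ x → mk⇔ (λ ()) (λ Px → contradiction Px (¬P x)) }

  cardinality-singleton : {P : Pred A 0ℓ} (x : A) → P x → (∀ y → P y → y ≡ x) → HasCardinality P 1
  cardinality-singleton x Px only = record
    { elements = x ∷ [] ; unique = [] AllPairs.∷ AllPairs.[] ; size = refl
    ; exact = λ y → mk⇔ (λ { (here refl) → Px }) (λ Py → here (only y Py)) }

  cardinality-resp-⇔ : {P Q : Pred A 0ℓ} {k : ℕ} → (∀ x → P x ⇔ Q x) →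
    HasCardinality P k → HasCardinality Q k
  cardinality-resp-⇔ P⇔Q hc = record
    { elements = elements ; unique = unique ; size = size
    ; exact = λ x → mk⇔ (to (P⇔Q x) ∘ to (exact x)) (from (exact x) ∘ from (P⇔Q x)) }
    where
    open HasCardinality hc
    open Equivalence

-- Prepending a letter is injective and words with different first letters differ, so the three
-- lists concatenate without repetition. The hypothesis on `[]` settles the only word that has no
-- first letter.
cardinality-firstStep : {P : Pred Path 0ℓ} {i j k : ℕ} → ¬ P [] →
  HasCardinality (P ∘ (N ∷_)) i → HasCardinality (P ∘ (E ∷_)) j → HasCardinality (P ∘ (D ∷_)) k →
  HasCardinality P (i + (j + k))
cardinality-firstStep {P} ¬P[] hN hE hD = record
  { elements = ns ++ (es ++ ds)
  ; unique = ++⁺ (uniq N hN) (++⁺ (uniq E hE) (uniq D hD) disjED) disjN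
  ; exact = λ w → mk⇔ (sound w) (complete w)
  ; size = trans (length-++ ns) (cong₂ _+_ (len N hN)
             (trans (length-++ es) (cong₂ _+_ (len E hE) (len D hD)))) }
  where
  open HasCardinality
  open Equivalence
  ns = map (N ∷_) (elements hN)
  es = map (E ∷_) (elements hE)
  ds = map (D ∷_) (elements hD)
  uniq : ∀ s {k} (h : HasCardinality (P ∘ (s ∷_)) k) → Unique (map (s ∷_) (elements h))
  uniq s h = map⁺ ∷-injectiveʳ (unique h)
  len : ∀ s {k} (h : HasCardinality (P ∘ (s ∷_)) k) → length (map (s ∷_) (elements h)) ≡ k
  len s h = trans (length-map (s ∷_) (elements h)) (size h)
  disjED : ∀ {w} → ¬ (w ∈ es × w ∈ ds)
  disjED (p , q) with ∈-map⁻ (E ∷_) p | ∈-map⁻ (D ∷_) q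
  ... | _ , _ , refl | _ , _ , ()
  disjN : ∀ {w} → ¬ (w ∈ ns × w ∈ es ++ ds)
  disjN (p , q) with ∈-map⁻ (N ∷_) p | ∈-++⁻ es q
  ... | _ , _ , refl | inj₁ r with ∈-map⁻ (E ∷_) r
  ...   | _ , _ , ()
  disjN (p , q) | _ , _ , refl | inj₂ r with ∈-map⁻ (D ∷_) r
  ...   | _ , _ , ()
  soundAt : ∀ s {k} (h : HasCardinality (P ∘ (s ∷_)) k) {w} → w ∈ map (s ∷_) (elements h) → P w
  soundAt s h r with ∈-map⁻ (s ∷_) r
  ... | v , v∈ , refl = to (exact h v) v∈
  sound : ∀ w → w ∈ ns ++ (es ++ ds) → P w
  sound w r with ∈-++⁻ ns r
  ... | inj₁ r₁ = soundAt N hN r₁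
  ... | inj₂ r₁ with ∈-++⁻ es r₁
  ...   | inj₁ r₂ = soundAt E hE r₂
  ...   | inj₂ r₂ = soundAt D hD r₂
  complete : ∀ w → P w → w ∈ ns ++ (es ++ ds)
  complete []      Pw = contradiction Pw ¬P[]
  complete (N ∷ w) Pw = ∈-++⁺ˡ (∈-map⁺ (N ∷_) (from (exact hN w) Pw))
  complete (E ∷ w) Pw = ∈-++⁺ʳ ns (∈-++⁺ˡ (∈-map⁺ (E ∷_) (from (exact hE w) Pw)))
  complete (D ∷ w) Pw = ∈-++⁺ʳ ns (∈-++⁺ʳ es (∈-map⁺ (D ∷_) (from (exact hD w) Pw)))

-- Binomial coefficients

-- Index `k - 1` under the convention C(n,-1) = 0. Truncated subtraction would give C(n,0) = 1 there
-- and break Pascal's rule at `k = 0`.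
shift : (ℕ → ℕ) → ℕ → ℕ
shift f zero    = 0
shift f (suc k) = f k

pascal : ∀ n k → suc n C k ≡ shift (n C_) k + n C k
pascal n zero    = refl
pascal n (suc k) = sym (nCk+nC[k+1]≡[n+1]C[k+1] n k)

shift-pascal : ∀ n k → shift (suc n C_) k ≡ shift (shift (n C_)) k + shift (n C_) k
shift-pascal n zero    = refl
shift-pascal n (suc k) = pascal n k

absorption : ∀ n k → suc k * (suc n C suc k) ≡ suc n * (n C k)
absorption n       zero    = trans (*-identityˡ _) (trans (nC1≡n (suc n)) (sym (*-identityʳ (suc n))))
absorption zero    (suc k) = *-zeroʳ (suc (suc k))
absorption (suc n) (suc k) = begin
  suc (suc k) * (suc (suc n) C suc (suc k))
    ≡⟨ cong (suc (suc k) *_) (nCk+nC[k+1]≡[n+1]C[k+1] (suc n) (suc k)) ⟨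
  -- One copy of `u` is set aside, so that the coefficients left on `u` and `v` are those of the two
  -- induction hypotheses.
  suc (suc k) * (u + v)
    ≡⟨ expand k u v ⟩
  u + (suc k * u + suc (suc k) * v)
    ≡⟨ cong₂ (λ x y → u + (x + y)) (absorption n k) (absorption n (suc k)) ⟩
  u + (suc n * (n C k) + suc n * (n C suc k))
    ≡⟨ cong (λ x → u + x) (*-distribˡ-+ (suc n) (n C k) (n C suc k)) ⟨
  u + suc n * (n C k + n C suc k)
    ≡⟨ cong (λ x → u + suc n * x) (nCk+nC[k+1]≡[n+1]C[k+1] n k) ⟩
  suc (suc n) * u ∎
  where
  open ≡-Reasoning
  u = suc n C suc k
  v = suc n C suc (suc k)
  expand : ∀ k u v → suc (suc k) * (u + v) ≡ u + (suc k * u + suc (suc k) * v)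
  expand = solve-∀

shift-absorption : ∀ n k → suc n * shift (n C_) k ≡ k * (suc n C k)
shift-absorption n zero    = *-zeroʳ (suc n)
shift-absorption n (suc k) = sym (absorption n k)

-- The number of multisets of size `a` from `M + 1` kinds. Indexing by one less than the number of
-- kinds, which are the remaining columns, keeps the upper entry free of subtraction.
multichoose : ℕ → ℕ → ℕ
multichoose M a = (M + a) C a

multichoose-sym : ∀ M a → multichoose M a ≡ (M + a) C M
multichoose-sym M a = trans (nCk≡nC[n∸k] (m≤n+m a M)) (cong ((M + a) C_) (m+n∸n≡m M a))

-- Pascal's rule read as a first step: one summand spends a north step, the other a column.
multichoose-pascal : ∀ M a → multichoose (suc M) a ≡ shift (multichoose (suc M)) a + multichoose M a
multichoose-pascal M zero    = refl
multichoose-pascal M (suc a) = trans (pascal (M + suc a) (suc a))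
  (cong (λ x → x C a + multichoose M (suc a)) (+-suc M a))

shift-multichoose-pascal : ∀ M a → shift (multichoose (suc (suc M))) a ≡
  shift (shift (multichoose (suc (suc M)))) a + shift (multichoose (suc M)) a
shift-multichoose-pascal M zero    = refl
shift-multichoose-pascal M (suc a) = multichoose-pascal (suc M) a

-- For positive `a`, absorption is used twice, at lower index `suc M` after symmetry and at lower
-- index `a` directly. Both sides meet in the same product.
shift-multichoose-absorption : ∀ M a →
  suc M * shift (multichoose (suc M)) a ≡ a * multichoose M a
shift-multichoose-absorption M zero    = *-zeroʳ (suc M)
shift-multichoose-absorption M (suc a) = begin
  suc M * multichoose (suc M) a     ≡⟨ cong (suc M *_) (multichoose-sym (suc M) a) ⟩
  suc M * (suc (M + a) C suc M)     ≡⟨ absorption (M + a) M ⟩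
  suc (M + a) * ((M + a) C M)       ≡⟨ cong (suc (M + a) *_) (multichoose-sym M a) ⟨
  suc (M + a) * ((M + a) C a)       ≡⟨ absorption (M + a) a ⟨
  suc a * (suc (M + a) C suc a)     ≡⟨ cong (λ x → suc a * (x C suc a)) (+-suc M a) ⟨
  suc a * multichoose M (suc a)     ∎
  where open ≡-Reasoning

-- The signed count and its closed form

module _ (m l : ℕ) where

  -- k = P B − m Q B − l P B′, with the subtrahends moved to the left.
  record Balance (P Q B B′ k : ℕ) : Set where
    constructor balanced
    field
      balance : k + (m * (Q * B) + l * (P * B′)) ≡ P * B

  balance-zeroˡ : ∀ B B′ → Balance 0 0 B B′ 0
  balance-zeroˡ B B′ = balanced (cong₂ _+_ (*-zeroʳ m) (*-zeroʳ l))

  balance-zeroʳ : ∀ P Q → Balance P Q 0 0 0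
  balance-zeroʳ P Q = balanced (trans
    (cong₂ _+_ (trans (cong (m *_) (*-zeroʳ Q)) (*-zeroʳ m)) (trans (cong (l *_) (*-zeroʳ P)) (*-zeroʳ l)))
    (sym (*-zeroʳ P)))

  -- The signed expression is linear in the pair (P, Q) and, as `balance-+ʳ` shows, in (B, B′).
  -- Hence Pascal's rule in either pair becomes addition of counts.
  balance-+ˡ : ∀ {P₁ P₂ Q₁ Q₂ B B′ i j} → Balance P₁ Q₁ B B′ i → Balance P₂ Q₂ B B′ j →
    Balance (P₁ + P₂) (Q₁ + Q₂) B B′ (i + j)
  balance-+ˡ {P₁} {P₂} {Q₁} {Q₂} {B} {B′} {i} {j} (balanced h₁) (balanced h₂) =
    balanced (trans (regroup m l P₁ P₂ Q₁ Q₂ B B′ i j) (trans (cong₂ _+_ h₁ h₂) (sym (*-distribʳ-+ B P₁ P₂))))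
    where
    regroup : ∀ m l P₁ P₂ Q₁ Q₂ B B′ i j →
      i + j + (m * ((Q₁ + Q₂) * B) + l * ((P₁ + P₂) * B′)) ≡
      (i + (m * (Q₁ * B) + l * (P₁ * B′))) + (j + (m * (Q₂ * B) + l * (P₂ * B′)))
    regroup = solve-∀

  balance-+ʳ : ∀ {P Q B₁ B₂ B₁′ B₂′ i j} → Balance P Q B₁ B₁′ i → Balance P Q B₂ B₂′ j →
    Balance P Q (B₁ + B₂) (B₁′ + B₂′) (i + j)
  balance-+ʳ {P} {Q} {B₁} {B₂} {B₁′} {B₂′} {i} {j} (balanced h₁) (balanced h₂) =
    balanced (trans (regroup m l P Q B₁ B₂ B₁′ B₂′ i j) (trans (cong₂ _+_ h₁ h₂) (sym (*-distribˡ-+ P B₁ B₂))))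
    where
    regroup : ∀ m l P Q B₁ B₂ B₁′ B₂′ i j →
      i + j + (m * (Q * (B₁ + B₂)) + l * (P * (B₁′ + B₂′))) ≡
      (i + (m * (Q * B₁) + l * (P * B₁′))) + (j + (m * (Q * B₂) + l * (P * B₂′)))
    regroup = solve-∀

  -- Multiplying the balance by `r` produces `m * r = suc M` and `l * r = suc c` in the subtrahends,
  -- which absorption turns into `a` and `d` times `P * B`. Thus r k = (r - a - d) P B.
  weighted-balance : ∀ {M c r} a d {k} → suc M ≡ m * r → suc c ≡ l * r →
    Balance (multichoose M a) (shift (multichoose (suc M)) a) (suc c C d) (shift (c C_) d) k →
    r * k + (a + d) * (multichoose M a * (suc c C d)) ≡ r * (multichoose M a * (suc c C d))
  weighted-balance {M} {c} {r} a d {k} M≡ c≡ (balanced h) = begin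
    r * k + (a + d) * (P * B)
      ≡⟨ cong (λ x → r * k + x) (split a d P B) ⟩
    r * k + ((a * P) * B + P * (d * B))
      ≡⟨ cong₂ (λ x y → r * k + (x * B + P * y)) (shift-multichoose-absorption M a) (shift-absorption c d) ⟨
    r * k + ((suc M * Q) * B + P * (suc c * B′))
      ≡⟨ cong₂ (λ x y → r * k + ((x * Q) * B + P * (y * B′))) M≡ c≡ ⟩
    r * k + ((m * r * Q) * B + P * (l * r * B′))
      ≡⟨ factor m l r k P Q B B′ ⟩
    r * (k + (m * (Q * B) + l * (P * B′)))
      ≡⟨ cong (r *_) h ⟩
    r * (P * B) ∎
    where
    open ≡-Reasoning
    P = multichoose M a
    Q = shift (multichoose (suc M)) a
    B = suc c C d
    B′ = shift (c C_) d
    split : ∀ a d P B → (a + d) * (P * B) ≡ (a * P) * B + P * (d * B)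
    split = solve-∀
    factor : ∀ m l r k P Q B B′ → r * k + ((m * r * Q) * B + P * (l * r * B′)) ≡
      r * (k + (m * (Q * B) + l * (P * B′)))
    factor = solve-∀

  -- The same computation at r = a + d, where the factor r - a - d is zero. Cancelling `r` is
  -- legitimate because `m * r` is a successor.
  balance-vanishes : ∀ {M c} a d → suc M ≡ m * (a + d) → suc c ≡ l * (a + d) →
    Balance (multichoose M a) (shift (multichoose (suc M)) a) (suc c C d) (shift (c C_) d) 0
  balance-vanishes {M} {c} a d M≡ c≡ =
    balanced (*-cancelˡ-≡ _ _ (a + d) {{≢-nonZero r≢0}} (begin
      (a + d) * (m * (Q * B) + l * (P * B′))
        ≡⟨ factor m l (a + d) P Q B B′ ⟩
      (m * (a + d) * Q) * B + P * (l * (a + d) * B′)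
        ≡⟨ cong₂ (λ x y → (x * Q) * B + P * (y * B′)) M≡ c≡ ⟨
      (suc M * Q) * B + P * (suc c * B′)
        ≡⟨ cong₂ (λ x y → x * B + P * y) (shift-multichoose-absorption M a) (shift-absorption c d) ⟩
      (a * P) * B + P * (d * B)
        ≡⟨ split a d P B ⟩
      (a + d) * (P * B) ∎))
    where
    open ≡-Reasoning
    P = multichoose M a
    Q = shift (multichoose (suc M)) a
    B = suc c C d
    B′ = shift (c C_) d
    r≢0 : a + d ≢ 0
    r≢0 r≡0 with () ← trans M≡ (trans (cong (m *_) r≡0) (*-zeroʳ m))
    split : ∀ a d P B → (a * P) * B + P * (d * B) ≡ (a + d) * (P * B)
    split = solve-∀
    factor : ∀ m l r P Q B B′ → r * (m * (Q * B) + l * (P * B′)) ≡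
      (m * r * Q) * B + P * (l * r * B′)
    factor = solve-∀

-- Suffixes of paths

-- Every return and every diagonal step uses up one unit of height.
valleys+diagonals≤rise : ∀ x y w →
  y + (length (valleysFrom (x , y) w) + length (diagonalStartsFrom (x , y) w)) ≤
  proj₂ (foldl move (x , y) w)
valleys+diagonals≤rise x y []          = ≤-reflexive (+-identityʳ y)
valleys+diagonals≤rise x y (N ∷ w)     = ≤-trans (n≤1+n _) (valleys+diagonals≤rise x (suc y) w)
valleys+diagonals≤rise x y (D ∷ w)     = ≤-trans
  (≤-reflexive (trans (cong (λ k → y + k) (+-suc _ _)) (+-suc y _)))
  (valleys+diagonals≤rise (suc x) (suc y) w)
valleys+diagonals≤rise x y (E ∷ [])    = ≤-reflexive (+-identityʳ y)
valleys+diagonals≤rise x y (E ∷ N ∷ w) = ≤-trans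
  (≤-reflexive (+-suc y _)) (valleys+diagonals≤rise (suc x) (suc y) w)
valleys+diagonals≤rise x y (E ∷ E ∷ w) = valleys+diagonals≤rise (suc x) y (E ∷ w)
valleys+diagonals≤rise x y (E ∷ D ∷ w) = valleys+diagonals≤rise (suc x) y (D ∷ w)

-- Ok x: a diagonal step may end at abscissa x.
record Suffix (m n : ℕ) (Ok : Pred ℕ 0ℓ) (p : Point) (b d : ℕ) (w : Path) : Set where
  constructor suffix
  field
    ends      : foldl move p w ≡ (m * n , n)
    above     : All (WeaklyAbove m) (scanl move p w)
    small     : All (λ q → ¬ OnLine m q) (diagonalStartsFrom p w)
    allowed   : All (λ q → Ok (proj₁ (move q D))) (diagonalStartsFrom p w)
    returns   : length (filter (returnPoint? m n) (valleysFrom p w)) ≡ b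
    diagonals : length (diagonalStartsFrom p w) ≡ d

module _ {m n : ℕ} {Ok : Pred ℕ 0ℓ} where

  suffix-N : ∀ {p b d} → WeaklyAbove m p → ∀ w →
    Suffix m n Ok (move p N) b d w ⇔ Suffix m n Ok p b d (N ∷ w)
  suffix-N p-above w = mk⇔
    (λ { (suffix e ab s al r d) → suffix e (p-above ∷ ab) s al r d })
    (λ { (suffix e (_ ∷ ab) s al r d) → suffix e ab s al r d })

  suffix-D : ∀ {x y b d} → x < m * y → Ok (suc x) → ∀ w →
    Suffix m n Ok (suc x , suc y) b d w ⇔ Suffix m n Ok (x , y) b (suc d) (D ∷ w)
  suffix-D x<my ok w = mk⇔
    (λ { (suffix e ab s al r d) → suffix e (<⇒≤ x<my ∷ ab) (<⇒≢ x<my ∷ s) (ok ∷ al) r (cong suc d) })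
    (λ { (suffix e (_ ∷ ab) (_ ∷ s) (_ ∷ al) r d) → suffix e ab s al r (suc-injective d) })

  -- The returns are among the valleys, so the bound on valleys and diagonals applies. It excludes a
  -- north step once only `b + d` rows remain.
  suffix-rise : ∀ {x y b d w} → Suffix m n Ok (x , y) b d w → y + (b + d) ≤ n
  suffix-rise {x} {y} {b} {d} {w} S = begin
    y + (b + d)
      ≤⟨ +-monoʳ-≤ y (+-mono-≤
           (≤-trans (≤-reflexive (sym returns)) (length-filter (returnPoint? m n) (valleysFrom (x , y) w)))
           (≤-reflexive (sym diagonals))) ⟩
    y + (length (valleysFrom (x , y) w) + length (diagonalStartsFrom (x , y) w))
      ≤⟨ valleys+diagonals≤rise x y w ⟩
    proj₂ (foldl move (x , y) w)
      ≡⟨ cong proj₂ ends ⟩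
    n ∎
    where
    open Suffix S
    open ≤-Reasoning

  -- `valleysFrom` looks one letter past an `E`, hence the split on the next letter. Only `N`
  -- creates a valley, which the filter then rejects.
  returns-E : ∀ {x y} → ¬ ReturnPoint m n (suc x , y) → ∀ w →
    length (filter (returnPoint? m n) (valleysFrom (x , y) (E ∷ w))) ≡
    length (filter (returnPoint? m n) (valleysFrom (suc x , y) w))
  returns-E ¬ret []      = refl
  returns-E ¬ret (N ∷ w) = cong length (filter-reject (returnPoint? m n) ¬ret)
  returns-E ¬ret (E ∷ w) = refl
  returns-E ¬ret (D ∷ w) = refl

  suffix-E : ∀ {x y b d} → x ≤ m * y → ¬ ReturnPoint m n (suc x , y) → ∀ w →
    Suffix m n Ok (suc x , y) b d w ⇔ Suffix m n Ok (x , y) b d (E ∷ w)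
  suffix-E x≤my ¬ret w = mk⇔
    (λ { (suffix e ab s al r d) → suffix e (x≤my ∷ ab) s al (trans (returns-E ¬ret w) r) d })
    (λ { (suffix e (_ ∷ ab) s al r d) → suffix e ab s al (trans (sym (returns-E ¬ret w)) r) d })

  returns-EN : ∀ {x y} → ReturnPoint m n (suc x , y) → ∀ w →
    length (filter (returnPoint? m n) (valleysFrom (x , y) (E ∷ N ∷ w))) ≡
    suc (length (filter (returnPoint? m n) (valleysFrom (suc x , suc y) w)))
  returns-EN ret w = cong length (filter-accept (returnPoint? m n) ret)

  -- A return is treated as the single block `E N`: the valley is visible only with both letters,
  -- and for positive `m` the block ends strictly above the line, so the recursion never starts from
  -- a point on the line.
  suffix-EN : ∀ {x y b d} → ReturnPoint m n (suc x , y) → ∀ w →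
    Suffix m n Ok (suc x , suc y) b d w ⇔ Suffix m n Ok (x , y) (suc b) d (E ∷ N ∷ w)
  suffix-EN ret@(on , _) w = mk⇔
    (λ { (suffix e ab s al r d) → suffix e (≤-trans (n≤1+n _) (≤-reflexive on) ∷ ≤-reflexive on ∷ ab) s al
           (trans (returns-EN ret w) (cong suc r)) d })
    (λ { (suffix e (_ ∷ _ ∷ ab) s al r d) → suffix e ab s al
           (suc-injective (trans (sym (returns-EN ret w)) r)) d })

  -- From a point on the line, E leaves the region and D is forbidden.
  suffix-EE : ∀ {x y b d} → suc x ≡ m * y → ∀ w → ¬ Suffix m n Ok (x , y) b d (E ∷ E ∷ w)
  suffix-EE on w (suffix _ (_ ∷ _ ∷ below ∷ _) _ _ _ _) = <⇒≱ below (≤-reflexive (sym on))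

  suffix-ED : ∀ {x y b d} → suc x ≡ m * y → ∀ w → ¬ Suffix m n Ok (x , y) b d (E ∷ D ∷ w)
  suffix-ED on w (suffix _ _ (¬on ∷ _) _ _ _) = ¬on on

  suffix-EN-suc : ∀ {x y d} → ReturnPoint m n (suc x , y) → ∀ w →
    ¬ Suffix m n Ok (x , y) 0 d (E ∷ N ∷ w)
  suffix-EN-suc ret w (suffix _ _ _ _ r _) with () ← trans (sym (returns-EN ret w)) r

  suffix-[] : ∀ {x y b d} → x ≢ m * n → ¬ Suffix m n Ok (x , y) b d []
  suffix-[] x≢mn (suffix e _ _ _ _ _) = x≢mn (cong proj₁ e)

  suffix-unfold : ∀ {x y b d i j k} → x ≢ m * n →
    HasCardinality (λ w → Suffix m n Ok (x , y) b d (N ∷ w)) i →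
    HasCardinality (λ w → Suffix m n Ok (x , y) b d (E ∷ w)) j →
    HasCardinality (λ w → Suffix m n Ok (x , y) b d (D ∷ w)) k →
    HasCardinality (Suffix m n Ok (x , y) b d) (i + (j + k))
  suffix-unfold x≢mn = cardinality-firstStep (suffix-[] x≢mn)

  cardinality-E-return : ∀ {x y b d k} → ReturnPoint m n (suc x , y) → suc x ≢ m * n →
    HasCardinality (λ w → Suffix m n Ok (x , y) b d (E ∷ N ∷ w)) k →
    HasCardinality (λ w → Suffix m n Ok (x , y) b d (E ∷ w)) k
  cardinality-E-return {k = k} (on , _) x≢mn hc = subst (HasCardinality _) (+-identityʳ k)
    (cardinality-firstStep (λ S → x≢mn (cong proj₁ (Suffix.ends S))) hc
      (cardinality-empty (suffix-EE on)) (cardinality-empty (suffix-ED on)))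

  cardinality-N-exhausted : ∀ {x y b d} → x ≤ m * y → y + (b + d) ≡ n →
    HasCardinality (λ w → Suffix m n Ok (x , y) b d (N ∷ w)) 0
  cardinality-N-exhausted x≤my y≡ = cardinality-resp-⇔ (suffix-N x≤my)
    (cardinality-empty λ w S → <-irrefl y≡ (suffix-rise S))

  cardinality-D-exhausted : ∀ {p b} → HasCardinality (λ w → Suffix m n Ok p b 0 (D ∷ w)) 0
  cardinality-D-exhausted = cardinality-empty λ { w (suffix _ _ _ _ _ ()) }

  cardinality-end : HasCardinality (Suffix m n Ok (m * n , n) 0 0) 1
  cardinality-end = cardinality-singleton [] (suffix refl (≤-refl ∷ []) [] [] refl refl) only
    where
    only : ∀ w → Suffix m n Ok (m * n , n) 0 0 w → w ≡ []
    only []      S = refl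
    only (N ∷ w) S = contradiction
      (≤-trans (s≤s (m≤m+n n 0)) (suffix-rise (Equivalence.from (suffix-N ≤-refl w) S))) (<-irrefl refl)
    only (E ∷ w) (suffix _ (_ ∷ below ∷ _) _ _ _ _) = contradiction below (<-irrefl refl)
    only (D ∷ w) (suffix _ _ _ _ _ ())

-- The first-step recurrence

-- c M + 1 is the number of abscissae allowed for diagonal steps when
-- M + 1 columns remain.
module Count (m n l : ℕ) .{{_ : NonZero m}} (Ok : Pred ℕ 0ℓ) (ok? : Decidable Ok) (c : ℕ → ℕ)
  (c-ok   : ∀ x M → suc x + suc M ≡ m * n → Ok (suc x) → c (suc M) ≡ suc (c M))
  (c-¬ok  : ∀ x M → suc x + suc M ≡ m * n → ¬ Ok (suc x) → c (suc M) ≡ c M)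
  (c-line : ∀ r M → suc M ≡ m * r → suc (c M) ≡ l * r) where

  Counts : (M a d k : ℕ) → Set
  Counts M a d k =
    Balance m l (multichoose M a) (shift (multichoose (suc M)) a) (suc (c M) C d) (shift (c M C_) d) k

  CountsSuffixes : (M a d : ℕ) → Pred Path 0ℓ → Set
  CountsSuffixes M a d P = ∃ λ k → HasCardinality P k × Counts M a d k

  -- This is `Counts` at `a - 1`, written with `shift` so that `a = 0` asks for the zero balance.
  CountsN : (M a d : ℕ) → Pred Path 0ℓ → Set
  CountsN M a d P = ∃ λ k → HasCardinality P k ×
    Balance m l (shift (multichoose M) a) (shift (shift (multichoose (suc M))) a)
      (suc (c M) C d) (shift (c M C_) d) k

  -- What the columns after the next one contribute once the next step is E or D.
  CountsED : (M a d : ℕ) → Pred Path 0ℓ → Pred Path 0ℓ → Set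
  CountsED M a d PE PD = ∃ λ i → ∃ λ j → HasCardinality PE i × HasCardinality PD j ×
    Balance m l (multichoose M a) (shift (multichoose (suc M)) a)
      (suc (c (suc M)) C d) (shift (c (suc M) C_) d) (i + j)

  combine : ∀ {x y b d} M a → x ≢ m * n →
    CountsN (suc M) a d (λ w → Suffix m n Ok (x , y) b d (N ∷ w)) →
    CountsED M a d (λ w → Suffix m n Ok (x , y) b d (E ∷ w)) (λ w → Suffix m n Ok (x , y) b d (D ∷ w)) →
    CountsSuffixes (suc M) a d (Suffix m n Ok (x , y) b d)
  combine {x} {y} {b} {d} M a x≢mn (i , hN , balN) (j , k , hE , hD , balED) =
    i + (j + k) , suffix-unfold x≢mn hN hE hD ,
    subst₂ (λ P Q → Balance m l P Q (suc (c (suc M)) C d) (shift (c (suc M) C_) d) (i + (j + k)))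
      (sym (multichoose-pascal M a)) (sym (shift-multichoose-pascal M a))
      (balance-+ˡ m l balN balED)

  -- Pascal's rule in the number of allowed columns: the next one either carries a diagonal, which
  -- lowers `d`, or does not.
  combineED : ∀ {PE PD : Pred Path 0ℓ} M a d x → suc x + suc M ≡ m * n → Ok (suc x) →
    CountsSuffixes M a d PE →
    (∃ λ k → HasCardinality PD k × Balance m l (multichoose M a) (shift (multichoose (suc M)) a)
      (shift (suc (c M) C_) d) (shift (shift (c M C_)) d) k) →
    CountsED M a d PE PD
  combineED M a d x x+M ok (i , hE , balE) (j , hD , balD) = i , j , hE , hD ,
    subst (λ e → Balance m l _ _ (suc e C d) (shift (e C_) d) (i + j)) (sym (c-ok x M x+M ok))
      (subst₂ (λ B B′ → Balance m l _ _ B B′ (i + j))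
        (sym (pascal (suc (c M)) d)) (sym (shift-pascal (c M) d))
        (subst (Balance m l _ _ _ _) (+-comm j i) (balance-+ʳ m l balD balE)))

  -- A column closed to diagonals leaves the number of allowed columns unchanged, so `E` alone
  -- carries the balance.
  skipED : ∀ {PE PD : Pred Path 0ℓ} M a d x → suc x + suc M ≡ m * n → ¬ Ok (suc x) →
    CountsSuffixes M a d PE → HasCardinality PD 0 → CountsED M a d PE PD
  skipED M a d x x+M ¬ok (i , hE , balE) hD = i , 0 , hE , hD ,
    subst₂ (λ e k → Balance m l _ _ (suc e C d) (shift (e C_) d) k)
      (sym (c-¬ok x M x+M ¬ok)) (sym (+-identityʳ i)) balE

  -- With one column left, being strictly above the line forces `y = n`. Hence `a`, `b` and `d` are
  -- zero and the only suffix is a single `E`.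
  count-last : ∀ a b d x y → x + 1 ≡ m * n → y + (a + b + d) ≡ n → x < m * y →
    CountsSuffixes 0 a d (Suffix m n Ok (x , y) b d)
  count-last a b d x y x+1 y+ x<my = go y+
    where
    sx≡mn : suc x ≡ m * n
    sx≡mn = trans (+-comm 1 x) x+1
    y≡n : y ≡ n
    y≡n = ≤-antisym (≤-trans (m≤m+n y _) (≤-reflexive y+))
      (*-cancelˡ-≤ m (subst (_≤ m * y) sx≡mn x<my))
    exhausted : a + b + d ≡ 0
    exhausted = +-cancelˡ-≡ y _ _ (trans y+ (trans (sym y≡n) (sym (+-identityʳ y))))
    a≡0 : a ≡ 0
    a≡0 = m+n≡0⇒m≡0 a (m+n≡0⇒m≡0 (a + b) exhausted)
    b≡0 : b ≡ 0
    b≡0 = m+n≡0⇒n≡0 a (m+n≡0⇒m≡0 (a + b) exhausted)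
    d≡0 : d ≡ 0
    d≡0 = m+n≡0⇒n≡0 (a + b) exhausted
    go : y + (a + b + d) ≡ n → CountsSuffixes 0 a d (Suffix m n Ok (x , y) b d)
    go y+ rewrite a≡0 | b≡0 | d≡0 =
      1 , suffix-unfold (<⇒≢ (≤-reflexive sx≡mn))
            (cardinality-N-exhausted (<⇒≤ x<my) y+)
            -- This `E` does reach the line, but at height `n`, where a point is not a return.
            (cardinality-resp-⇔ (suffix-E (<⇒≤ x<my) (λ ret → <-irrefl y≡n (proj₂ (proj₂ ret))))
              (subst₂ (λ u v → HasCardinality (Suffix m n Ok (u , v) 0 0) 1) (sym sx≡mn) (sym y≡n)
                cardinality-end))
            cardinality-D-exhausted ,
      balanced (cong suc (cong₂ _+_ (*-zeroʳ m) (*-zeroʳ l)))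

  -- Here `a` is the number of north steps other than those forced after a return. The recursion is
  -- lexicographic: `N` lowers `a` and keeps `M`, while `E`, `D` and the block `E N` lower `M`.
  count : ∀ M a b d x y → x + suc M ≡ m * n → y + (a + b + d) ≡ n → x < m * y →
    CountsSuffixes M a d (Suffix m n Ok (x , y) b d)

  count-N : ∀ M a b d x y → x + suc M ≡ m * n → y + (a + b + d) ≡ n → x < m * y →
    CountsN M a d (λ w → Suffix m n Ok (x , y) b d (N ∷ w))
  count-E : ∀ M a b d x y → suc x + suc M ≡ m * n → y + (a + b + d) ≡ n → x < m * y →
    CountsSuffixes M a d (λ w → Suffix m n Ok (x , y) b d (E ∷ w))
  count-ED : ∀ M a b d x y → suc x + suc M ≡ m * n → y + (a + b + d) ≡ n → x < m * y →
    CountsED M a d (λ w → Suffix m n Ok (x , y) b d (E ∷ w)) (λ w → Suffix m n Ok (x , y) b d (D ∷ w))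

  count zero    a b d x y x+ y+ x<my = count-last a b d x y x+ y+ x<my
  count (suc M) a b d x y x+ y+ x<my = combine M a
    (<⇒≢ (≤-trans (m<m+n x (s≤s z≤n)) (≤-reflexive x+)))
    (count-N (suc M) a b d x y x+ y+ x<my)
    (count-ED M a b d x y (trans (sym (+-suc x (suc M))) x+) y+ x<my)

  count-N M zero b d x y x+ y+ x<my =
    0 , cardinality-N-exhausted (<⇒≤ x<my) y+ , balance-zeroˡ m l _ _
  count-N M (suc a) b d x y x+ y+ x<my
    with count M a b d x (suc y) x+ (trans (sym (+-suc y _)) y+) (≤-trans x<my (*-monoʳ-≤ m (n≤1+n y)))
  ... | k , hc , bal = k , cardinality-resp-⇔ (suffix-N (<⇒≤ x<my)) hc , bal

  count-E M a b d x y x+ y+ x<my with m≤n⇒m<n∨m≡n x<my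
  ... | inj₁ sx<my with count M a b d (suc x) y x+ y+ sx<my
  ...   | k , hc , bal =
          k , cardinality-resp-⇔ (suffix-E (<⇒≤ x<my) (λ ret → <⇒≢ sx<my (proj₁ ret))) hc , bal
  count-E M a b d x y x+ y+ x<my | inj₂ sx≡my = onLine b y+
    where
    -- At least one column remains beyond `suc x`, so the line is met below height `n` and the point
    -- is a genuine return.
    sx<mn : suc x < m * n
    sx<mn = ≤-trans (m<m+n (suc x) (s≤s z≤n)) (≤-reflexive x+)
    y<n : y < n
    y<n = *-cancelˡ-< m y n (subst (_< m * n) sx≡my sx<mn)
    y≢0 : y ≢ 0
    y≢0 y≡0 with () ← trans sx≡my (trans (cong (m *_) y≡0) (*-zeroʳ m))
    ret : ReturnPoint m n (suc x , y)
    ret = sx≡my , n≢0⇒n>0 y≢0 , y<n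
    onLine : ∀ b → y + (a + b + d) ≡ n →
      CountsSuffixes M a d (λ w → Suffix m n Ok (x , y) b d (E ∷ w))
    onLine zero y+ = 0 ,
      cardinality-E-return ret (<⇒≢ sx<mn) (cardinality-empty (suffix-EN-suc ret)) ,
      balance-vanishes m l a d M+1≡ (c-line (a + d) M M+1≡)
      where
      M+1≡ : suc M ≡ m * (a + d)
      M+1≡ = +-cancelˡ-≡ (m * y) _ _ (begin
        m * y + suc M        ≡⟨ cong (λ z → z + suc M) sx≡my ⟨
        suc x + suc M        ≡⟨ x+ ⟩
        m * n                ≡⟨ cong (m *_) y+ ⟨
        m * (y + (a + 0 + d)) ≡⟨ cong (λ z → m * (y + (z + d))) (+-identityʳ a) ⟩
        m * (y + (a + d))    ≡⟨ *-distribˡ-+ m y (a + d) ⟩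
        m * y + m * (a + d)  ∎)
        where open ≡-Reasoning
    -- The forced `N` uses up one row and one return together, so `a`, `d` and the balance stay as
    -- they are.
    onLine (suc b) y+
      with count M a b d (suc x) (suc y) x+
             (trans (rearrange y a b d) y+)
             (≤-trans (s≤s (≤-reflexive sx≡my)) (*-monoʳ-< m (n<1+n y)))
      where
      rearrange : ∀ y a b d → suc y + (a + b + d) ≡ y + (a + suc b + d)
      rearrange = solve-∀
    ... | k , hc , bal =
      k , cardinality-E-return ret (<⇒≢ sx<mn) (cardinality-resp-⇔ (suffix-EN ret) hc) , bal

  count-ED M a b d x y x+ y+ x<my with ok? (suc x)
  ... | no ¬ok = skipED M a d x x+ ¬ok (count-E M a b d x y x+ y+ x<my)
    (cardinality-empty λ { w (suffix _ _ _ (ok ∷ _) _ _) → ¬ok ok })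
  count-ED M a b zero x y x+ y+ x<my | yes ok =
    combineED M a 0 x x+ ok (count-E M a b 0 x y x+ y+ x<my)
      (0 , cardinality-D-exhausted , balance-zeroʳ m l _ _)
  count-ED M a b (suc d) x y x+ y+ x<my | yes ok
    with count M a b d (suc x) (suc y) x+
           (trans (rearrange y a b d) y+)
           (≤-trans (s≤s x<my) (*-monoʳ-< m (n<1+n y)))
    where
    rearrange : ∀ y a b d → suc y + (a + b + d) ≡ y + (a + b + suc d)
    rearrange = solve-∀
  ... | k , hc , bal = combineED M a (suc d) x x+ ok (count-E M a b (suc d) x y x+ y+ x<my)
    (k , cardinality-resp-⇔ (suffix-D x<my ok) hc , bal)

  -- The north steps are peeled off from the front, so the height `y` already reached is a parameter
  -- and `t + y` stays constant.
  cardinality-prefix : ∀ t y {b d k} → HasCardinality (Suffix m n Ok (0 , t + y) b d) k →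
    HasCardinality (λ w → take t w ≡ replicate t N × Suffix m n Ok (0 , y) b d w) k
  cardinality-prefix zero    y hc = cardinality-resp-⇔ (λ w → mk⇔ (refl ,_) proj₂) hc
  cardinality-prefix (suc t) y {b} {d} {k} hc = subst (HasCardinality _) (+-identityʳ k)
    (cardinality-firstStep (λ ())
      (cardinality-resp-⇔ prepend (cardinality-prefix t (suc y)
        (subst (λ z → HasCardinality (Suffix m n Ok (0 , z) b d) k) (sym (+-suc t y)) hc)))
      (cardinality-empty λ w ())
      (cardinality-empty λ w ()))
    where
    prepend : ∀ w → (take t w ≡ replicate t N × Suffix m n Ok (0 , suc y) b d w) ⇔
      (take (suc t) (N ∷ w) ≡ replicate (suc t) N × Suffix m n Ok (0 , y) b d (N ∷ w))
    prepend w = mk⇔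
      (λ { (pre , S) → cong (N ∷_) pre , Equivalence.to (suffix-N z≤n w) S })
      (λ { (pre , S) → ∷-injectiveʳ pre , Equivalence.from (suffix-N z≤n w) S })

  count-paths : ∀ t a b d .{{_ : NonZero n}} .{{_ : NonZero t}} → t + (a + b + d) ≡ n →
    ∃ λ k → HasCardinality (λ w → take t w ≡ replicate t N × Suffix m n Ok origin b d w) k ×
      n * k ≡ (t + b) * (((m * n + a ∸ 1) C a) * ((l * n) C d))
  count-paths t a b d t+ = fromColumns (ℕ.pred (m * n)) (suc-pred (m * n) {{m*n≢0 m n}})
    where
    regroup : ∀ t a b d → t + (a + b + d) ≡ (t + b) + (a + d)
    regroup = solve-∀
    fromColumns : ∀ M → suc M ≡ m * n →
      ∃ λ k → HasCardinality (λ w → take t w ≡ replicate t N × Suffix m n Ok origin b d w) k ×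
        n * k ≡ (t + b) * (((m * n + a ∸ 1) C a) * ((l * n) C d))
    -- Since `t` is positive, the point `(0 , t)` lies strictly above the line, as `count` demands.
    fromColumns M M≡ with count M a b d 0 t M≡ t+ (≤-trans (ℕ.>-nonZero⁻¹ t) (m≤n*m t m))
    ... | k , hc , bal = k , cardinality-prefix t 0
            (subst (λ z → HasCardinality (Suffix m n Ok (0 , z) b d) k) (sym (+-identityʳ t)) hc) ,
          -- `suc M + a ∸ 1` reduces to `M + a`, which matches `multichoose M a`. The weighted
          -- balance is taken at r = n = (t + b) + (a + d), and cancelling the `a + d` part leaves
          -- the factor `t + b`.
          subst₂ (λ u v → n * k ≡ (t + b) * (((u + a ∸ 1) C a) * (v C d))) M≡ (c-line n M M≡)
            (+-cancelʳ-≡ ((a + d) * PB) _ _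
              (trans (weighted-balance m l a d M≡ (c-line n M M≡) bal)
                (trans (cong (_* PB) (trans (sym t+) (regroup t a b d))) (*-distribʳ-+ PB (t + b) (a + d)))))
      where
      PB = multichoose M a * (suc (c M) C d)

-- Divisible columns

module _ (m : ℕ) .{{_ : NonZero m}} where

  [r+q*m]/m≡q : ∀ r q → r < m → (r + q * m) ℕ./ m ≡ q
  [r+q*m]/m≡q r q r<m = trans (+-distrib-/-∣ʳ r (divides-refl q)) (cong₂ _+_ (m<n⇒m/n≡0 r<m) (m*n/n≡m q m))

  -- From M + 1 = (q + 1) m follows M = (m - 1) + q m, whose quotient is q.
  suc-/-∣ : ∀ M → m ∣ suc M → suc M ℕ./ m ≡ suc (M ℕ./ m)
  suc-/-∣ M (divides (suc q) M≡) = trans (cong (ℕ._/ m) M≡) (trans (m*n/n≡m (suc q) m)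
    (cong suc (sym (trans (cong (ℕ._/ m) M≡′) ([r+q*m]/m≡q (ℕ.pred m) q (≤-reflexive (suc-pred m)))))))
    where
    M≡′ : M ≡ ℕ.pred m + q * m
    M≡′ = suc-injective (trans M≡ (cong (_+ q * m) (sym (suc-pred m))))

  -- The remainder of `suc M` is some `suc r`, so `M` has remainder `r` and the same quotient.
  suc-/-∤ : ∀ M → ¬ m ∣ suc M → suc M ℕ./ m ≡ M ℕ./ m
  suc-/-∤ M ¬m∣ with suc M % m in r≡ | m≡m%n+[m/n]*n (suc M) m | m%n<n (suc M) m
  ... | zero  | _  | _   = contradiction (m%n≡0⇒n∣m (suc M) m r≡) ¬m∣
  ... | suc r | M≡ | r<m = sym (trans (cong (ℕ._/ m) (suc-injective M≡))
    ([r+q*m]/m≡q r (suc M ℕ./ m) (<⇒≤ r<m)))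

-- Rational form and the two cases

ι-quotient : ∀ n .{{_ : NonZero n}} k s P B → n * k ≡ s * (P * B) →
  ι k ≡ ((+ s / n) *ℚ ι P) *ℚ ι B
-- For unnormalised rationals equality is cross multiplication, so the gcd normalisation behind
-- `_/_` and `_*ℚ_` need not be unfolded.
ι-quotient (suc n) k s P B nk≡ = toℚᵘ-injective (begin
  toℚᵘ (ι k)
    ≈⟨ toℚᵘ-fromℚᵘ (mkℚᵘ (+ k) 0) ⟩
  mkℚᵘ (+ k) 0
    ≈⟨ *≡* crossMultiplied ⟩
  (mkℚᵘ (+ s) n *ᵘ mkℚᵘ (+ P) 0) *ᵘ mkℚᵘ (+ B) 0
    ≈⟨ ℚᵘ.*-cong (ℚᵘ.*-cong (toℚᵘ-fromℚᵘ (mkℚᵘ (+ s) n)) (toℚᵘ-fromℚᵘ (mkℚᵘ (+ P) 0)))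
         (toℚᵘ-fromℚᵘ (mkℚᵘ (+ B) 0)) ⟨
  (toℚᵘ (+ s / suc n) *ᵘ toℚᵘ (ι P)) *ᵘ toℚᵘ (ι B)
    ≈⟨ ℚᵘ.*-congʳ (toℚᵘ-homo-* (+ s / suc n) (ι P)) ⟨
  toℚᵘ ((+ s / suc n) *ℚ ι P) *ᵘ toℚᵘ (ι B)
    ≈⟨ toℚᵘ-homo-* ((+ s / suc n) *ℚ ι P) (ι B) ⟨
  toℚᵘ (((+ s / suc n) *ℚ ι P) *ℚ ι B) ∎)
  where
  open ℚᵘ.≃-Reasoning
  crossMultiplied : + k ℤ.* + (suc n * 1 * 1) ≡ ((+ s ℤ.* + P) ℤ.* + B) ℤ.* + 1
  crossMultiplied = trans (sym (ℤ.pos-* k (suc n * 1 * 1)))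
    (trans (cong +_ (trans (clearOnes k (suc n)) (trans nk≡ (sym (*-assoc s P B)))))
      (trans (ℤ.pos-* (s * P) B)
        (trans (cong (ℤ._* + B) (ℤ.pos-* s P)) (sym (ℤ.*-identityʳ _)))))
    where
    clearOnes : ∀ k n → k * (n * 1 * 1) ≡ n * k
    clearOnes = solve-∀

suffix⇔smallSchröder : ∀ {m t n b d w} →
  (take t w ≡ replicate t N × Suffix m n (λ _ → ⊤) origin b d w) ⇔ SmallSchröder m t n b d w
suffix⇔smallSchröder = mk⇔
  (λ { (pre , suffix e ab s _ r d) →
       record { ends = e ; above = ab ; startsNorth = pre ; small = s } , r , d })
  (λ { (S , r , d) → let open IsSmallSchröder S in
       startsNorth , suffix ends above small (universal (λ _ → tt) _) r d })

suffix⇔divisibleSmallSchröder : ∀ {m t n b d w} →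
  (take t w ≡ replicate t N × Suffix m n (m ∣_) origin b d w) ⇔ DivisibleSmallSchröder m t n b d w
suffix⇔divisibleSmallSchröder = mk⇔
  (λ { (pre , suffix e ab s al r d) →
       al , record { ends = e ; above = ab ; startsNorth = pre ; small = s } , r , d })
  (λ { (al , S , r , d) → let open IsSmallSchröder S in startsNorth , suffix ends above small al r d })

theorem1p2 : (m n t : ℕ) .{{_ : NonZero m}} .{{_ : NonZero n}} .{{_ : NonZero t}} →
    t ≤ n → (a b : ℕ) → a + b ≤ n ∸ t →
    (∃ λ k → HasCardinality (SmallSchröder m t n b (n ∸ t ∸ a ∸ b)) k ×
    ι k ≡ ((+ (t + b) / n) *ℚ ι ((m * n + a ∸ 1) C a)) *ℚ ι ((m * n) C (n ∸ t ∸ a ∸ b)))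
    ×
    (∃ λ k → HasCardinality (DivisibleSmallSchröder m t n b (n ∸ t ∸ a ∸ b)) k ×
    ι k ≡ ((+ (t + b) / n) *ℚ ι ((m * n + a ∸ 1) C a)) *ℚ ι (n C (n ∸ t ∸ a ∸ b)))
theorem1p2 m n t t≤n a b a+b≤n∸t = all , divisible
  where
  d = n ∸ t ∸ a ∸ b
  heights : t + (a + b + d) ≡ n
  heights = trans (cong (λ z → t + (a + b + z)) (∸-+-assoc (n ∸ t) a b))
    (trans (cong (λ z → t + z) (m+[n∸m]≡n a+b≤n∸t)) (m+[n∸m]≡n t≤n))
  all : ∃ λ k → HasCardinality (SmallSchröder m t n b d) k ×
    ι k ≡ ((+ (t + b) / n) *ℚ ι ((m * n + a ∸ 1) C a)) *ℚ ι ((m * n) C d)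
  -- Every abscissa is allowed: `M + 1` remaining columns give `M + 1` choices, and `m` per row on
  -- the line.
  all with Count.count-paths m n m (λ _ → ⊤) (λ _ → yes tt) (λ M → M)
    (λ _ _ _ _ → refl) (λ _ _ _ ¬ok → ⊥-elim (¬ok tt)) (λ _ _ M≡ → M≡) t a b d heights
  ... | k , hc , nk≡ = k , cardinality-resp-⇔ (λ _ → suffix⇔smallSchröder) hc ,
    ι-quotient n k (t + b) ((m * n + a ∸ 1) C a) ((m * n) C d) nk≡
  divisible : ∃ λ k → HasCardinality (DivisibleSmallSchröder m t n b d) k ×
    ι k ≡ ((+ (t + b) / n) *ℚ ι ((m * n + a ∸ 1) C a)) *ℚ ι (n C d)
  -- The last `M + 1` abscissae up to `m * n` contain `M / m + 1` multiples of `m`. As the abscissa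
  -- and the number of columns after it sum to `m * n`, `m` divides one exactly when it divides the
  -- other.
  divisible with Count.count-paths m n 1 (m ∣_) (m ∣?_) (ℕ._/ m)
    (λ x M x+M m∣x → suc-/-∣ m M (∣m+n∣m⇒∣n (subst (m ∣_) (sym x+M) (m∣m*n n)) m∣x))
    (λ x M x+M m∤x → suc-/-∤ m M λ m∣M →
      m∤x (∣m+n∣m⇒∣n (subst (m ∣_) (trans (sym x+M) (+-comm (suc x) (suc M))) (m∣m*n n)) m∣M))
    (λ r M M≡ → trans (sym (suc-/-∣ m M (subst (m ∣_) (sym M≡) (m∣m*n r))))
      (trans (cong (ℕ._/ m) (trans M≡ (*-comm m r))) (trans (m*n/n≡m r m) (sym (*-identityˡ r)))))
    t a b d heights
  ... | k , hc , nk≡ = k , cardinality-resp-⇔ (λ _ → suffix⇔divisibleSmallSchröder) hc ,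
    ι-quotient n k (t + b) ((m * n + a ∸ 1) C a) (n C d)
      (subst (λ z → n * k ≡ (t + b) * (((m * n + a ∸ 1) C a) * (z C d))) (*-identityˡ n) nk≡)
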